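{- Let $\alpha=(\alpha_1,\dots,\alpha_k)$ be a composition of $n$ with $k$ parts. Fix positive integers $i_1<i_2<\dots<i_k$ and consider the set of all words (rearrangements) of the multiset containing $i_j$ with multiplicity $\alpha_j$ for $j=1,\dots,k$ (i.e. words with this fixed content, whose packed content is $\alpha$). Then the number of Sylvester equivalence classes of these words is \[\det\left[\binom{\,j+\sum_{\ell=1}^{i}\alpha_{k+1-\ell}\,}{\,j-(i-1)\,}\right]_{1\le i,j\le k-1}\] (the empty determinant, for $k=1$, being $1$).
   Context: Words are finite sequences of positive integers. The packed content of a word is the composition listing the multiplicities of its distinct letters in increasing order of the letters. Two words $w_1,w_2$ are Sylvester adjacent if there are words $u,v,w$ and letters $a\le b<c$ with $w_1=u\,a\,c\,v\,b\,w$ and $w_2=u\,c\,a\,v\,b\,w$ (concatenation). Sylvester equivalence is the equivalence relation generated by Sylvester adjacency (words $u,v$ are equivalent if there is a chain $u=x_1,x_2,\dots,x_m=v$ with consecutive terms Sylvester adjacent). A binomial coefficient $\binom{N}{r}$ with $r<0$ is $0$. -}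

module Defs where

import Algebra.Properties.CommutativeMonoid.Sum as Sum
open import Data.Fin.Base as Fin using (Fin; Fin′; zero; suc; toℕ; inject; opposite; punchIn)
open import Data.Integer.Base as ℤ using (ℤ; +_; -[1+_]; _⊖_; 1ℤ; -1ℤ)
import Data.Integer.Properties as ℤ
open import Data.List.Base using (List; _∷_; _++_; concat; replicate; tabulate)
open import Data.List.Relation.Binary.Permutation.Propositional using (_↭_)
open import Data.Nat.Base as ℕ using (ℕ; zero; suc; _≤_; _<_)
open import Data.Nat.Combinatorics using (_C_)
import Data.Nat.Properties as ℕ
open import Data.Product.Base using (Σ; proj₁)
open import Data.Refinement.Base using (Refinement; value)
open import Function.Bundles using (Bijection)
open import Level using (Level; 0ℓ; _⊔_)
open import Relation.Binary.Bundles using (Setoid)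
open import Relation.Binary.Core using (Rel)
import Relation.Binary.Construct.Closure.Equivalence as Closure
import Relation.Binary.Construct.On as On
open import Relation.Binary.PropositionalEquality.Core using (_≡_)
import Relation.Binary.PropositionalEquality.Properties as ≡

open Sum ℕ.+-0-commutativeMonoid public using () renaming (sum to sumℕ)
open Sum ℤ.+-0-commutativeMonoid public using () renaming (sum to sumℤ)

record Composition (n k : ℕ) : Set where
  field
    part     : Fin k → ℕ
    positive : ∀ j → 0 < part j
    total    : sumℕ part ≡ n

open Composition public

Letter : Set
Letter = Refinement ℕ (0 <_)

infix 4 _≤ᴸ_ _<ᴸ_

_≤ᴸ_ _<ᴸ_ : Rel Letter 0ℓ
a ≤ᴸ b = value a ≤ value b
a <ᴸ b = value a < value b

Word : Set
Word = List Letter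

data SylvesterAdjacent : Rel Word 0ℓ where
  adjacent : ∀ (u v w : Word) {a b c : Letter} → a ≤ᴸ b → b <ᴸ c →
             SylvesterAdjacent (u ++ a ∷ c ∷ v ++ b ∷ w)
                               (u ++ c ∷ a ∷ v ++ b ∷ w)

StrictlyIncreasing : ∀ {k} → (Fin k → Letter) → Set
StrictlyIncreasing letter = ∀ {p q} → p Fin.< q → letter p <ᴸ letter q

-- Rearrangements of the multiset in which letter j has multiplicity
-- mult j.  A rearrangement is a word together with a derivation of _↭_;
-- since derivations are not unique, this type is only meant to be used
-- up to relations on the underlying words.
Rearrangement : ∀ {k} → (Fin k → Letter) → (Fin k → ℕ) → Set
Rearrangement letter mult =
  Σ Word λ w → w ↭ concat (tabulate λ j → replicate (mult j) (letter j))

Sylvester : ∀ {k} → (Fin k → Letter) → (Fin k → ℕ) → Setoid 0ℓ 0ℓ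
Sylvester letter mult =
  On.setoid {B = Rearrangement letter mult}
    (Closure.setoid SylvesterAdjacent) proj₁

-- A bijection of setoids is injective up to the equivalence of S, so it
-- amounts to a bijection between the equivalence classes of S and Fin N.
HasClassCount : ∀ {a ℓ : Level} → Setoid a ℓ → ℕ → Set (a ⊔ ℓ)
HasClassCount S N = Bijection S (≡.setoid (Fin N))

Matrix : ℕ → Set
Matrix m = Fin m → Fin m → ℤ

-- Laplace expansion along the first column.
det : ∀ {m} → Matrix m → ℤ
det {zero}  M = 1ℤ
det {suc m} M = sumℤ λ i →
  (-1ℤ ℤ.^ toℕ i) ℤ.* M i zero ℤ.* det (λ p q → M (punchIn i p) (suc q))

binomial : ℕ → ℤ → ℕ
binomial N (+ r)    = N C r
binomial N -[1+ r ] = 0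

-- With k = suc m parts the matrix has size k - 1 = m.  Indices are shifted
-- to start at 0: rows and columns i , j stand for 1 + i , 1 + j, so
-- j - (i - 1) becomes (1 + j) - i, and the sum over ℓ = 1 , … , i runs over
-- Fin (1 + i), whose elements select parts counted from the end.
sylvesterMatrix : ∀ {m} → (Fin (suc m) → ℕ) → Matrix m
sylvesterMatrix α i j =
  + binomial (suc (toℕ j) ℕ.+ sumℕ lastParts) (suc (toℕ j) ⊖ toℕ i)
  where
  lastParts : Fin′ (suc i) → ℕ
  lastParts ℓ = α (opposite (inject {i = suc i} ℓ))

{-# OPTIONS --safe #-}

-- Inserted from right to left into a binary search tree, a word determines its
-- Sylvester class, and the left spine of the tree consists of the weak
-- right-to-left minima of the word.  Let v be the subword of letters larger than
-- the smallest letter a.  Copies of a commute with every letter that is not such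
-- a minimum, so the class of the word is determined by the class of v and the
-- number j of minima of v to the right of the last a; any j up to the number of
-- minima of v occurs, and the new word has j + α_a minima.  Hence the classes
-- correspond to the sequences j₁ = 0, 0 ≤ jᵢ₊₁ ≤ jᵢ + αₖ₊₁₋ᵢ.  The matrix is upper
-- Hessenberg with ones below the diagonal, and expanding its determinant along
-- the first column is summation by parts in the count of these sequences.

module Submission where

open import Defs
import Algebra.Properties.CommutativeMonoid.Sum as Sum
open import Data.Fin.Base using (Fin; zero; suc; toℕ; fromℕ; fromℕ<; inject; inject₁; opposite; punchIn)
open import Data.Fin.Properties
  using (toℕ-inject₁; toℕ-fromℕ; toℕ-fromℕ<; toℕ-injective; toℕ≤pred[n]; +↔⊎)
open import Data.Integer.Base as ℤ using (ℤ; +_; _⊖_; 1ℤ; -1ℤ)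
import Data.Integer.Properties as ℤ
import Data.Integer.Tactic.RingSolver as ℤ-Solver
open import Data.List.Base using ([]; _∷_; _++_; length; replicate; filter; concat; tabulate)
open import Data.List.Properties
  using (++-assoc; ++-identityʳ; length-++; length-replicate; filter-accept; filter-reject)
open import Data.List.Relation.Binary.Permutation.Propositional
  using (_↭_; ↭-refl; ↭-sym; ↭-trans; prep; swap)
open import Data.List.Relation.Binary.Permutation.Propositional.Properties
  using (All-resp-↭; Any-resp-↭; ↭-length; filter-↭; ↭-empty-inv; shift)
  renaming (++⁺ˡ to ↭-++⁺ˡ)
open import Data.List.Relation.Unary.All as All using (All; []; _∷_; all?)
open import Data.List.Relation.Unary.All.Properties using (¬All⇒Any¬)
  renaming (++⁺ to All-++⁺; replicate⁺ to All-replicate⁺; concat⁺ to All-concat⁺; tabulate⁺ to All-tabulate⁺)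
open import Data.List.Relation.Unary.Any as Any using (Any; here; there)
open import Data.List.Relation.Unary.Any.Properties using () renaming (++⁺ʳ to Any-++⁺ʳ)
open import Data.Nat.Base as ℕ using (ℕ; zero; suc; _+_; _*_; _≤_; _<_; z≤n; z<s; s≤s; s≤s⁻¹; s<s)
open import Data.Nat.Combinatorics using (_C_; nCn≡1; nCk+nC[k+1]≡[n+1]C[k+1])
open import Data.Nat.Properties
  using (_≤?_; _<?_; ≤-refl; ≤-trans; ≤-antisym; ≤-<-trans; <-≤-trans; <⇒≤; <⇒≱; ≰⇒>; n≤1+n;
    n<1+n; +-comm; +-suc; +-identityʳ; *-identityʳ; +-cancelʳ-≡; <-irrefl; ≮⇒≥;
    +-0-commutativeMonoid)
open import Data.Nat.Tactic.RingSolver using (solve-∀)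
open import Data.Product.Base using (Σ; ∃; _×_; _,_; proj₁; proj₂)
open import Data.Product.Function.Dependent.Propositional using (congˡ)
open import Data.Refinement.Base using (value)
open import Data.Refinement.Properties using (value-injective)
open import Data.Sum.Base using (_⊎_; inj₁; inj₂; [_,_]′)
open import Data.Sum.Function.Propositional using (_⊎-↔_)
open import Data.Unit.Base using (⊤; tt)
open import Function.Base using (_∘_; id; const)
open import Function.Bundles using (_↔_; mk↔ₛ′; module Inverse; module Injection)
open import Function.Construct.Composition using (_↔-∘_)
open import Function.Construct.Identity using (↔-id)
open import Function.Construct.Symmetry using (↔-sym)
open import Function.Properties.Inverse using (↔⇒↣)
open import Function.Related.TypeIsomorphisms using (Σ-assoc)
open import Level using (0ℓ)
import Relation.Binary.Construct.Closure.Equivalence as Closure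
open import Relation.Binary.Construct.Closure.ReflexiveTransitive using (ε; _◅_; _◅◅_)
open import Relation.Binary.Construct.Closure.Symmetric using (fwd; bwd)
open import Relation.Binary.Core using (Rel)
open import Relation.Binary.PropositionalEquality
open import Relation.Nullary using (¬_; yes; no; contradiction)

open Sum +-0-commutativeMonoid using ()
  renaming (sum-cong-≗ to sumℕ-cong; sum-init-last to sumℕ-init-last)
open Sum ℤ.+-0-commutativeMonoid using ()
  renaming (sum-cong-≗ to sumℤ-cong; sum-replicate-zero to sumℤ-zero)

-- Binomial sums and the determinant

Σ≤ : ℕ → (ℕ → ℕ) → ℕ
Σ≤ s f = sumℕ {suc s} (f ∘ toℕ)

Σ≤-cong : ∀ s {f g : ℕ → ℕ} → f ≗ g → Σ≤ s f ≡ Σ≤ s g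
Σ≤-cong s f≗g = sumℕ-cong {suc s} (f≗g ∘ toℕ)

Σ≤-zero : ∀ f → Σ≤ 0 f ≡ f 0
Σ≤-zero f = +-identityʳ (f 0)

Σ≤-suc : ∀ s f → Σ≤ (suc s) f ≡ Σ≤ s f + f (suc s)
Σ≤-suc s f = trans (sumℕ-init-last {suc s} (f ∘ toℕ))
  (cong₂ _+_ (sumℕ-cong {suc s} (cong f ∘ toℕ-inject₁)) (cong f (toℕ-fromℕ (suc s))))

pascal : ∀ B r → (suc B + r) C r + (suc B + r) C suc r ≡ (suc B + suc r) C suc r
pascal B r = trans (nCk+nC[k+1]≡[n+1]C[k+1] (suc B + r) r)
                   (cong (_C suc r) (sym (+-suc (suc B) r)))

-- Summation by parts, with the subtracted sum moved to the left-hand side so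
-- that the identity lives in ℕ.
Σ≤-by-parts : ∀ B r b f →
  Σ≤ B (λ j → ((j + r) C r) * Σ≤ (j + b) f) +
  Σ≤ B (λ j → ((j + suc r) C suc r) * f (suc (j + b)))
    ≡ ((B + suc r) C suc r) * Σ≤ (suc (B + b)) f
Σ≤-by-parts zero r b f = begin
  Σ≤ 0 g + Σ≤ 0 h                              ≡⟨ cong₂ _+_ (Σ≤-zero g) (Σ≤-zero h) ⟩
  (r C r) * Σ≤ b f + (suc r C suc r) * f (suc b)
    ≡⟨ cong (λ c → c * Σ≤ b f + (suc r C suc r) * f (suc b)) (trans (nCn≡1 r) (sym (nCn≡1 (suc r)))) ⟩
  (suc r C suc r) * Σ≤ b f + (suc r C suc r) * f (suc b) ≡⟨ distrib (suc r C suc r) _ _ ⟩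
  (suc r C suc r) * (Σ≤ b f + f (suc b))       ≡⟨ cong ((suc r C suc r) *_) (Σ≤-suc b f) ⟨
  (suc r C suc r) * Σ≤ (suc b) f               ∎
  where
  open ≡-Reasoning
  g h : ℕ → ℕ
  g j = ((j + r) C r) * Σ≤ (j + b) f
  h j = ((j + suc r) C suc r) * f (suc (j + b))
  distrib : ∀ x y z → x * y + x * z ≡ x * (y + z)
  distrib = solve-∀
Σ≤-by-parts (suc B) r b f = begin
  Σ≤ (suc B) g + Σ≤ (suc B) h                ≡⟨ cong₂ _+_ (Σ≤-suc B g) (Σ≤-suc B h) ⟩
  (Σ≤ B g + c * S) + (Σ≤ B h + c″ * x)       ≡⟨ regroup (Σ≤ B g) (Σ≤ B h) (c * S) (c″ * x) ⟩
  (Σ≤ B g + Σ≤ B h) + (c * S + c″ * x)       ≡⟨ cong (_+ (c * S + c″ * x)) (Σ≤-by-parts B r b f) ⟩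
  ((B + suc r) C suc r) * S + (c * S + c″ * x) ≡⟨ cong (λ n → (n C suc r) * S + (c * S + c″ * x)) (+-suc B r) ⟩
  c′ * S + (c * S + c″ * x)                  ≡⟨ collect c c′ (c″ * x) S ⟩
  (c + c′) * S + c″ * x                      ≡⟨ cong (λ c → c * S + c″ * x) (pascal B r) ⟩
  c″ * S + c″ * x                            ≡⟨ distrib c″ S x ⟩
  c″ * (S + x)                               ≡⟨ cong (c″ *_) (Σ≤-suc (suc (B + b)) f) ⟨
  c″ * Σ≤ (suc (suc (B + b))) f              ∎
  where
  open ≡-Reasoning
  g h : ℕ → ℕ
  g j = ((j + r) C r) * Σ≤ (j + b) f
  h j = ((j + suc r) C suc r) * f (suc (j + b))
  S x c c′ c″ : ℕ
  S = Σ≤ (suc (B + b)) f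
  x = f (suc (suc (B + b)))
  c = (suc B + r) C r
  c′ = (suc B + r) C suc r
  c″ = (suc B + suc r) C suc r
  regroup : ∀ x y z w → (x + z) + (y + w) ≡ (x + y) + (z + w)
  regroup = solve-∀
  collect : ∀ c c′ y S → c′ * S + (c * S + y) ≡ (c + c′) * S + y
  collect = solve-∀
  distrib : ∀ x y z → x * y + x * z ≡ x * (y + z)
  distrib = solve-∀

-- This is the base case of the determinant: when one row is left every count is 1, and only the
-- binomial weights are summed.
hockeyStick : ∀ B r → Σ≤ B (λ j → ((j + r) C r) * 1) ≡ (B + suc r) C suc r
hockeyStick zero r = begin
  Σ≤ 0 g          ≡⟨ Σ≤-zero g ⟩
  (r C r) * 1     ≡⟨ *-identityʳ (r C r) ⟩
  r C r           ≡⟨ nCn≡1 r ⟩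
  1               ≡⟨ nCn≡1 (suc r) ⟨
  suc r C suc r   ∎
  where
  open ≡-Reasoning
  g : ℕ → ℕ
  g j = ((j + r) C r) * 1
hockeyStick (suc B) r = begin
  Σ≤ (suc B) g                                    ≡⟨ Σ≤-suc B g ⟩
  Σ≤ B g + ((suc B + r) C r) * 1                  ≡⟨ cong₂ _+_ (hockeyStick B r) (*-identityʳ _) ⟩
  (B + suc r) C suc r + (suc B + r) C r           ≡⟨ cong (λ n → n C suc r + (suc B + r) C r) (+-suc B r) ⟩
  (suc B + r) C suc r + (suc B + r) C r           ≡⟨ +-comm ((suc B + r) C suc r) _ ⟩
  (suc B + r) C r + (suc B + r) C suc r           ≡⟨ pascal B r ⟩
  (suc B + suc r) C suc r                         ∎
  where
  open ≡-Reasoning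
  g : ℕ → ℕ
  g j = ((j + r) C r) * 1

-- The number of sequences j₁ , … , jₖ with j₁ ≤ s and jᵢ₊₁ ≤ jᵢ + βᵢ.  The last
-- entry of β plays no role, which is why the first part of the composition does
-- not occur in the matrix.
count : ∀ {k} → ℕ → (Fin k → ℕ) → ℕ
count {zero}  s β = 1
count {suc k} s β = Σ≤ s λ j → count (j + β zero) (β ∘ suc)

-- Expanding along the first column replaces the weight 1 of the values j₁ ≤ B
-- by binomial weights.
weighted : ∀ {m} → ℕ → ℕ → (Fin (suc m) → ℕ) → ℕ
weighted B r b = Σ≤ B λ j → ((j + r) C r) * count (j + b zero) (b ∘ suc)

weighted-zero : ∀ {m} B (b : Fin (suc m) → ℕ) → weighted B 0 b ≡ count B b
weighted-zero B b = Σ≤-cong B λ j →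
  +-identityʳ (count (j + b zero) (b ∘ suc))

-- Deleting the second row fuses two increments; the extra 1 comes from the
-- column shift in the minor.
merge : ∀ {m} → (Fin (suc (suc m)) → ℕ) → Fin (suc m) → ℕ
merge b zero    = suc (b zero + b (suc zero))
merge b (suc i) = b (suc (suc i))

-- Summation by parts for the two outermost sums: the boundary term is a full count with bound
-- `suc (B + b zero)`, and the correction fuses the first two increments. The two terms will match
-- the two cofactors of a Hessenberg expansion.
weighted-expansion : ∀ {m} B r (b : Fin (suc (suc m)) → ℕ) →
  weighted B r b + weighted B (suc r) (merge b)
    ≡ ((B + suc r) C suc r) * count (suc (B + b zero)) (b ∘ suc)
weighted-expansion B r b = trans
  (cong (weighted B r b ℕ.+_) (Σ≤-cong B λ j →
    cong (λ s → ((j + suc r) C suc r) * count s b″) (shuffle j (b zero) (b (suc zero)))))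
  (Σ≤-by-parts B r (b zero) λ i → count (i + b (suc zero)) b″)
  where
  b″ = λ i → b (suc (suc i))
  shuffle : ∀ j x y → j + suc (x + y) ≡ suc (j + x) + y
  shuffle = solve-∀

-- Hessenberg determinants

det-cong : ∀ {m} {M M′ : Matrix m} → (∀ i j → M i j ≡ M′ i j) → det M ≡ det M′
det-cong {zero}  M≗M′ = refl
det-cong {suc m} M≗M′ = sumℤ-cong {suc m} λ i →
  cong₂ (λ x d → (-1ℤ ℤ.^ toℕ i) ℤ.* x ℤ.* d) (M≗M′ i zero)
        (det-cong λ p q → M≗M′ (punchIn i p) (suc q))

minor : ∀ {m} → Fin (suc m) → Matrix (suc m) → Matrix m
minor i M p q = M (punchIn i p) (suc q)

det-hessenberg : ∀ {m} (M : Matrix (suc (suc m))) →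
  M (suc zero) zero ≡ 1ℤ → (∀ i → M (suc (suc i)) zero ≡ ℤ.0ℤ) →
  det M ≡ M zero zero ℤ.* det (minor zero M) ℤ.- det (minor (suc zero) M)
det-hessenberg {m} M M₁₀≡1 below≡0 = begin
  1ℤ ℤ.* x ℤ.* d₀ ℤ.+ (-1ℤ ℤ.* M (suc zero) zero ℤ.* d₁ ℤ.+ sumℤ rest)
    ≡⟨ cong₂ (λ y z → 1ℤ ℤ.* x ℤ.* d₀ ℤ.+ (-1ℤ ℤ.* y ℤ.* d₁ ℤ.+ z)) M₁₀≡1 rest≡0 ⟩
  1ℤ ℤ.* x ℤ.* d₀ ℤ.+ (-1ℤ ℤ.* 1ℤ ℤ.* d₁ ℤ.+ ℤ.0ℤ)
    ≡⟨ simplify x d₀ d₁ ⟩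
  x ℤ.* d₀ ℤ.- d₁ ∎
  where
  open ≡-Reasoning
  x d₀ d₁ : ℤ
  x = M zero zero
  d₀ = det (minor zero M)
  d₁ = det (minor (suc zero) M)
  sign : Fin m → ℤ
  sign i = -1ℤ ℤ.^ toℕ (suc (suc i))
  d : Fin m → ℤ
  d i = det (minor (suc (suc i)) M)
  rest : Fin m → ℤ
  rest i = sign i ℤ.* M (suc (suc i)) zero ℤ.* d i
  rest≡0 : sumℤ rest ≡ ℤ.0ℤ
  rest≡0 = trans (sumℤ-cong {m} λ i → begin
    sign i ℤ.* M (suc (suc i)) zero ℤ.* d i ≡⟨ cong (λ y → sign i ℤ.* y ℤ.* d i) (below≡0 i) ⟩
    sign i ℤ.* ℤ.0ℤ ℤ.* d i                 ≡⟨ cong (ℤ._* d i) (ℤ.*-zeroʳ (sign i)) ⟩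
    ℤ.0ℤ ℤ.* d i                            ≡⟨ ℤ.*-zeroˡ (d i) ⟩
    ℤ.0ℤ                                    ∎)
    (sumℤ-zero m)
  simplify : ∀ x y z → 1ℤ ℤ.* x ℤ.* y ℤ.+ (-1ℤ ℤ.* 1ℤ ℤ.* z ℤ.+ ℤ.0ℤ) ≡ x ℤ.* y ℤ.- z
  simplify = ℤ-Solver.solve-∀

prefixSum : ∀ {k} → (Fin k → ℕ) → Fin k → ℕ
prefixSum b i = sumℕ {toℕ i} λ ℓ → b (inject {i = i} ℓ)

-- The first row is generalised so that the family is closed under deleting the first column
-- together with either of the first two rows. Deleting the second row raises `r` by one; deleting
-- the first resets `r` to 0 and enlarges `B`.
hessenberg : ∀ {m} → ℕ → ℕ → (Fin (suc m) → ℕ) → Matrix (suc m)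
hessenberg B r b zero    j = + ((suc r + toℕ j + B) C (suc r + toℕ j))
hessenberg B r b (suc i) j = + binomial (suc (toℕ j) + (B + prefixSum b (suc i))) (toℕ j ⊖ toℕ i)

hessenberg-minor₀ : ∀ {m} B r (b : Fin (suc (suc m)) → ℕ) p q →
  minor zero (hessenberg B r b) p q
    ≡ hessenberg (suc (B + b zero)) 0 (b ∘ suc) p q
hessenberg-minor₀ B r b zero q = cong (λ N → + (N C suc (toℕ q))) (shuffle (toℕ q) B (b zero))
  where
  shuffle : ∀ j B x → suc (suc j) + (B + (x + 0)) ≡ suc j + suc (B + x)
  shuffle = solve-∀
hessenberg-minor₀ B r b (suc p) q = cong₂ (λ N d → + binomial N d)
  (shuffle (toℕ q) B (b zero) (prefixSum (b ∘ suc) (suc p)))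
  (ℤ.[1+m]⊖[1+n]≡m⊖n (toℕ q) (toℕ p))
  where
  shuffle : ∀ j B x y → suc (suc j) + (B + (x + y)) ≡ suc j + (suc (B + x) + y)
  shuffle = solve-∀

hessenberg-minor₁ : ∀ {m} B r (b : Fin (suc (suc m)) → ℕ) p q →
  minor (suc zero) (hessenberg B r b) p q
    ≡ hessenberg B (suc r) (merge b) p q
hessenberg-minor₁ B r b zero q = cong (λ c → + ((c + B) C c)) (cong suc (+-suc r (toℕ q)))
hessenberg-minor₁ B r b (suc p) q = cong₂ (λ N d → + binomial N d)
  (shuffle (toℕ q) B (b zero) (b (suc zero)) (prefixSum (λ i → b (suc (suc i))) p))
  (ℤ.[1+m]⊖[1+n]≡m⊖n (toℕ q) (toℕ p))
  where
  shuffle : ∀ j B x y z → suc (suc j) + (B + (x + (y + z))) ≡ suc j + (B + (suc (x + y) + z))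
  shuffle = solve-∀

-- By induction on the size, the first minor is an unweighted count and the second a weighted sum
-- with merged increments, so the cofactor expansion is `weighted-expansion` with one term moved
-- across.
det-hessenberg≡weighted : ∀ {m} B r (b : Fin (suc m) → ℕ) →
  det (hessenberg B r b) ≡ + weighted B r b
det-hessenberg≡weighted {zero} B r b = begin
  1ℤ ℤ.* x ℤ.* 1ℤ ℤ.+ ℤ.0ℤ  ≡⟨ simplify x ⟩
  x                         ≡⟨ cong +_ (cong₂ _C_ (shuffle r B) (+-identityʳ (suc r))) ⟩
  + ((B + suc r) C suc r)   ≡⟨ cong +_ (hockeyStick B r) ⟨
  + weighted B r b          ∎
  where
  open ≡-Reasoning
  x : ℤ
  x = hessenberg B r b zero zero
  simplify : ∀ x → 1ℤ ℤ.* x ℤ.* 1ℤ ℤ.+ ℤ.0ℤ ≡ x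
  simplify = ℤ-Solver.solve-∀
  shuffle : ∀ r B → suc r + 0 + B ≡ B + suc r
  shuffle = solve-∀
det-hessenberg≡weighted {suc m} B r b = begin
  det M
    -- From the second row on, the lower indices in the first column are 0, -1, -2, ..., which gives
    -- the entries 1, 0, 0, ....
    ≡⟨ det-hessenberg M refl (λ _ → refl) ⟩
  M zero zero ℤ.* det (minor zero M) ℤ.- det (minor (suc zero) M)
    ≡⟨ cong₂ (λ d₀ d₁ → M zero zero ℤ.* d₀ ℤ.- d₁)
         (trans (det-cong (hessenberg-minor₀ B r b)) (det-hessenberg≡weighted (suc (B + b zero)) 0 (b ∘ suc)))
         (trans (det-cong (hessenberg-minor₁ B r b)) (det-hessenberg≡weighted B (suc r) (merge b))) ⟩
  M zero zero ℤ.* + weighted (suc (B + b zero)) 0 (b ∘ suc) ℤ.- + w′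
    ≡⟨ cong₂ (λ c t → + c ℤ.* + t ℤ.- + w′) (cong₂ _C_ (shuffle r B) (+-identityʳ (suc r)))
         (weighted-zero (suc (B + b zero)) (b ∘ suc)) ⟩
  + c ℤ.* + t ℤ.- + w′
    ≡⟨ cong (ℤ._- + w′) (ℤ.pos-* c t) ⟨
  + (c * t) ℤ.- + w′
    ≡⟨ cong (λ n → + n ℤ.- + w′) (weighted-expansion B r b) ⟨
  + (w + w′) ℤ.- + w′
    ≡⟨ cong (ℤ._- + w′) (ℤ.pos-+ w w′) ⟩
  + w ℤ.+ + w′ ℤ.- + w′
    ≡⟨ cancel (+ w) (+ w′) ⟩
  + w ∎
  where
  open ≡-Reasoning
  M : Matrix (suc (suc m))
  M = hessenberg B r b
  w w′ c t : ℕ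
  w = weighted B r b
  w′ = weighted B (suc r) (merge b)
  c = (B + suc r) C suc r
  t = count (suc (B + b zero)) (b ∘ suc)
  shuffle : ∀ r B → suc r + 0 + B ≡ B + suc r
  shuffle = solve-∀
  cancel : ∀ x y → x ℤ.+ y ℤ.- y ≡ x
  cancel = ℤ-Solver.solve-∀

-- The first entry of a counted sequence is forced to be 0, so `β zero` is the bound for the second
-- entry and takes the place of `B`.
det-sylvesterMatrix : ∀ {m} (α : Fin (suc m) → ℕ) →
  det (sylvesterMatrix α) ≡ + count 0 (α ∘ opposite)
det-sylvesterMatrix {zero}  α = refl
det-sylvesterMatrix {suc m} α = begin
  det (sylvesterMatrix α)      ≡⟨ det-cong entry ⟩
  det (hessenberg (β zero) 0 (β ∘ suc)) ≡⟨ det-hessenberg≡weighted (β zero) 0 (β ∘ suc) ⟩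
  + weighted (β zero) 0 (β ∘ suc)       ≡⟨ cong +_ (weighted-zero (β zero) (β ∘ suc)) ⟩
  + count (β zero) (β ∘ suc)            ≡⟨ cong +_ (Σ≤-zero (λ j → count (j + β zero) (β ∘ suc))) ⟨
  + count 0 β                           ∎
  where
  open ≡-Reasoning
  β : Fin (suc (suc m)) → ℕ
  β = α ∘ opposite
  entry : ∀ i j → sylvesterMatrix α i j ≡ hessenberg (β zero) 0 (β ∘ suc) i j
  entry zero j = cong (λ s → + ((suc (toℕ j) + s) C suc (toℕ j))) (+-identityʳ (β zero))
  entry (suc i) j = cong (λ d → + binomial (suc (toℕ j) + (β zero + prefixSum (β ∘ suc) (suc i))) d)
    (ℤ.[1+m]⊖[1+n]≡m⊖n (toℕ j) (toℕ i))

-- Sylvester classes and right-to-left minima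

infix 4 _≈_
_≈_ : Rel Word 0ℓ
_≈_ = Closure.EqClosure SylvesterAdjacent

≈-reflexive : ∀ {w w′} → w ≡ w′ → w ≈ w′
≈-reflexive refl = ε

≈-sym : ∀ {w w′} → w ≈ w′ → w′ ≈ w
≈-sym = Closure.symmetric SylvesterAdjacent

≈-∷ : ∀ x {w w′} → w ≈ w′ → x ∷ w ≈ x ∷ w′
≈-∷ x = Closure.gmap (x ∷_) λ { (adjacent u v w a≤b b<c) → adjacent (x ∷ u) v w a≤b b<c }

≈-++ : ∀ u {w w′} → w ≈ w′ → u ++ w ≈ u ++ w′
≈-++ []      w≈w′ = w≈w′
≈-++ (x ∷ u) w≈w′ = ≈-∷ x (≈-++ u w≈w′)

_≤_<_ᴸ : Letter → Letter → Letter → Set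
a ≤ b < c ᴸ = a ≤ᴸ b × b <ᴸ c

-- Adjacency restated so that induction on the common prefix is structural.
data Swap : Rel Word 0ℓ where
  here  : ∀ {a c w} → Any (λ b → a ≤ b < c ᴸ) w → Swap (a ∷ c ∷ w) (c ∷ a ∷ w)
  there : ∀ {x w w′} → Swap w w′ → Swap (x ∷ w) (x ∷ w′)

adjacent⇒swap : ∀ {w w′} → SylvesterAdjacent w w′ → Swap w w′
adjacent⇒swap (adjacent []      v w a≤b b<c) = here (Any-++⁺ʳ v (here (a≤b , b<c)))
adjacent⇒swap (adjacent (x ∷ u) v w a≤b b<c) = there (adjacent⇒swap (adjacent u v w a≤b b<c))

between⇒adjacent : ∀ {a c w} → Any (λ b → a ≤ b < c ᴸ) w → SylvesterAdjacent (a ∷ c ∷ w) (c ∷ a ∷ w)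
between⇒adjacent any = split [] any
  where
  -- `v` accumulates the letters passed on the way to the witness `b`.
  split : ∀ {a c w} v → Any (λ b → a ≤ b < c ᴸ) w → SylvesterAdjacent (a ∷ c ∷ v ++ w) (c ∷ a ∷ v ++ w)
  split v (here {xs = w} (a≤b , b<c)) = adjacent [] v w a≤b b<c
  split {a} {c} v (there {x = x} {xs = w} any) =
    subst (λ t → SylvesterAdjacent (a ∷ c ∷ t) (c ∷ a ∷ t)) (++-assoc v (x ∷ []) w) (split (v ++ x ∷ []) any)
    where open import Data.List.Properties using (++-assoc)

≈-swap : ∀ {a c w} → Any (λ b → a ≤ b < c ᴸ) w → a ∷ c ∷ w ≈ c ∷ a ∷ w
≈-swap = Closure.return ∘ between⇒adjacent

swap⇒↭ : ∀ {w w′} → Swap w w′ → w ↭ w′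
swap⇒↭ (here _)  = swap _ _ ↭-refl
swap⇒↭ (there s) = prep _ (swap⇒↭ s)

between⇒< : ∀ a c {w} → Any (λ b → a ≤ b < c ᴸ) w → a <ᴸ c
between⇒< a c any = let _ , a≤b , b<c = Any.satisfied any in ≤-<-trans a≤b b<c

minimum? : ∀ x w → All (x ≤ᴸ_) w ⊎ Any (_<ᴸ x) w
minimum? x w with all? (λ y → value x ≤? value y) w
... | yes x≤w = inj₁ x≤w
... | no  x≰w = inj₂ (Any.map ≰⇒> (¬All⇒Any¬ (λ y → value x ≤? value y) w x≰w))

¬minimum : ∀ x {w} → All (x ≤ᴸ_) w → ¬ Any (_<ᴸ x) w
¬minimum x (x≤y ∷ _) (here y<x)  = <⇒≱ y<x x≤y
¬minimum x (_ ∷ x≤w) (there any) = ¬minimum x x≤w any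

-- The number of weak right-to-left minima, i.e. the length of the left spine of
-- the binary search tree of a word.
minima : Word → ℕ
minima []      = 0
minima (x ∷ w) = [ const suc , const id ]′ (minimum? x w) (minima w)

minima-accept : ∀ {x w} → All (x ≤ᴸ_) w → minima (x ∷ w) ≡ suc (minima w)
minima-accept {x} {w} x≤w with minimum? x w
... | inj₁ _   = refl
... | inj₂ any = contradiction any (¬minimum x x≤w)

minima-reject : ∀ {x w} → Any (_<ᴸ x) w → minima (x ∷ w) ≡ minima w
minima-reject {x} {w} any with minimum? x w
... | inj₁ x≤w = contradiction any (¬minimum x x≤w)
... | inj₂ _   = refl

minima-≤ : ∀ x w → minima w ≤ minima (x ∷ w)
minima-≤ x w with minimum? x w
... | inj₁ _ = n≤1+n _
... | inj₂ _ = ≤-refl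

minima-≤-suc : ∀ x w → minima (x ∷ w) ≤ suc (minima w)
minima-≤-suc x w with minimum? x w
... | inj₁ _ = ≤-refl
... | inj₂ _ = n≤1+n _

-- The letter `c` is a minimum on neither side, because the smaller witness stays to its right;
-- moving the larger `c` past `a` does not affect whether `a` is one. Letters further left see the
-- same multiset to their right.
minima-swap : ∀ {w w′} → Swap w w′ → minima w ≡ minima w′
minima-swap (there {x} {w} {w′} s) with minimum? x w
... | inj₁ x≤w = trans (cong suc (minima-swap s)) (sym (minima-accept (All-resp-↭ (swap⇒↭ s) x≤w)))
... | inj₂ any = trans (minima-swap s) (sym (minima-reject (Any-resp-↭ (swap⇒↭ s) any)))
minima-swap (here {a} {c} {w} between) = [ accept , reject ]′ (minimum? a w)
  where
  open ≡-Reasoning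
  a<c : a <ᴸ c
  a<c = between⇒< a c between
  c-reject : minima (c ∷ w) ≡ minima w
  c-reject = minima-reject (Any.map proj₂ between)
  accept : All (a ≤ᴸ_) w → minima (a ∷ c ∷ w) ≡ minima (c ∷ a ∷ w)
  accept a≤w = begin
    minima (a ∷ c ∷ w)   ≡⟨ minima-accept (<⇒≤ a<c ∷ a≤w) ⟩
    suc (minima (c ∷ w)) ≡⟨ cong suc c-reject ⟩
    suc (minima w)       ≡⟨ minima-accept a≤w ⟨
    minima (a ∷ w)       ≡⟨ minima-reject (here a<c) ⟨
    minima (c ∷ a ∷ w)   ∎
  reject : Any (_<ᴸ a) w → minima (a ∷ c ∷ w) ≡ minima (c ∷ a ∷ w)
  reject any = begin
    minima (a ∷ c ∷ w) ≡⟨ minima-reject (there any) ⟩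
    minima (c ∷ w)     ≡⟨ c-reject ⟩
    minima w           ≡⟨ minima-reject any ⟨
    minima (a ∷ w)     ≡⟨ minima-reject (here a<c) ⟨
    minima (c ∷ a ∷ w) ∎

minima-cong : ∀ {w w′} → w ≈ w′ → minima w ≡ minima w′
minima-cong = Closure.gfold isEquivalence minima (minima-swap ∘ adjacent⇒swap)

-- Restriction to the larger letters

above : Letter → Word → Word
above a = filter λ x → value a <? value x

above-accept : ∀ a x w → a <ᴸ x → above a (x ∷ w) ≡ x ∷ above a w
above-accept a x w = filter-accept (λ y → value a <? value y) {xs = w}

above-reject : ∀ a x w → ¬ a <ᴸ x → above a (x ∷ w) ≡ above a w
above-reject a x w = filter-reject (λ y → value a <? value y) {xs = w}

above-between : ∀ t a c {w} → t <ᴸ a → Any (λ b → a ≤ b < c ᴸ) w → Any (λ b → a ≤ b < c ᴸ) (above t w)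
above-between t a c t<a (here {b} {w} p@(a≤b , _)) rewrite above-accept t b w (<-≤-trans t<a a≤b) = here p
above-between t a c t<a (there {x = x} {xs = w} any) with value t <? value x
... | yes t<x rewrite above-accept t x w t<x = there (above-between t a c t<a any)
... | no  t≮x rewrite above-reject t x w t≮x = above-between t a c t<a any

-- If both exchanged letters survive, so does the witness, which is at least the smaller of them.
-- Otherwise the smaller one is deleted and the exchange becomes invisible.
above-swap : ∀ t {w w′} → Swap w w′ → above t w ≈ above t w′
above-swap t (there {x} {w} {w′} s) with value t <? value x
... | yes t<x rewrite above-accept t x w t<x | above-accept t x w′ t<x = ≈-∷ x (above-swap t s)
... | no  t≮x rewrite above-reject t x w t≮x | above-reject t x w′ t≮x = above-swap t s
above-swap t (here {a} {c} {w} any) with value t <? value a | value t <? value c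
... | yes t<a | yes t<c
  rewrite above-accept t a (c ∷ w) t<a | above-accept t c w t<c | above-accept t c (a ∷ w) t<c | above-accept t a w t<a
  = ≈-swap (above-between t a c t<a any)
... | yes t<a | no  t≮c = contradiction (<-≤-trans t<a (<⇒≤ (between⇒< a c any))) t≮c
... | no  t≮a | yes t<c
  rewrite above-reject t a (c ∷ w) t≮a | above-accept t c w t<c | above-accept t c (a ∷ w) t<c | above-reject t a w t≮a
  = ε
... | no  t≮a | no  t≮c
  rewrite above-reject t a (c ∷ w) t≮a | above-reject t c w t≮c | above-reject t c (a ∷ w) t≮c | above-reject t a w t≮a
  = ε

above-cong : ∀ t {w w′} → w ≈ w′ → above t w ≈ above t w′
above-cong t = Closure.gfold (Closure.isEquivalence SylvesterAdjacent) (above t) (above-swap t ∘ adjacent⇒swap)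

-- Shuffling copies of a smallest letter into a word

data Inserted (a : Letter) : ℕ → Word → Word → Set where
  []    : Inserted a 0 [] []
  here  : ∀ {n v w} → Inserted a n v w → Inserted a (suc n) v (a ∷ w)
  there : ∀ {n v w x} → a <ᴸ x → Inserted a n v w → Inserted a n (x ∷ v) (x ∷ w)

module _ {a : Letter} where

  inserted-> : ∀ {n v w} → Inserted a n v w → All (a <ᴸ_) v
  inserted-> []            = []
  inserted-> (here i)      = inserted-> i
  inserted-> (there a<x i) = a<x ∷ inserted-> i

  inserted-≥ : ∀ {n v w} → Inserted a n v w → All (a ≤ᴸ_) w
  inserted-≥ []            = []
  inserted-≥ (here i)      = ≤-refl ∷ inserted-≥ i
  inserted-≥ (there a<x i) = <⇒≤ a<x ∷ inserted-≥ i

  inserted-zero : ∀ {v w} → Inserted a 0 v w → w ≡ v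
  inserted-zero []          = refl
  inserted-zero (there _ i) = cong (_ ∷_) (inserted-zero i)

  inserted-any : ∀ {n v w} {P : Letter → Set} → P a → Inserted a (suc n) v w → Any P w
  inserted-any pa (here _)    = here pa
  inserted-any pa (there _ i) = there (inserted-any pa i)

  inserted-any-tail : ∀ {n v w} {P : Letter → Set} → Any P v → Inserted a n v w → Any P w
  inserted-any-tail any       (here i)    = there (inserted-any-tail any i)
  inserted-any-tail (here p)  (there _ i) = here p
  inserted-any-tail (there p) (there _ i) = there (inserted-any-tail p i)

  inserted-↭ : ∀ {n v w} → Inserted a n v w → w ↭ replicate n a ++ v
  inserted-↭ []       = ↭-refl
  inserted-↭ (here i) = prep a (inserted-↭ i)
  inserted-↭ (there {n} {v} {w} {x} _ i) =
    ↭-trans (prep x (inserted-↭ i)) (↭-sym (shift x (replicate n a) v))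

  inserted-above : ∀ {n v w} → Inserted a n v w → above a w ≡ v
  inserted-above []       = refl
  inserted-above (here {w = w} i) = trans (above-reject a a w (<-irrefl refl)) (inserted-above i)
  inserted-above (there {w = w} {x} a<x i) = trans (above-accept a x w a<x) (cong (x ∷_) (inserted-above i))

  above-inserted : ∀ {w} → All (a ≤ᴸ_) w → ∃ λ n → Inserted a n (above a w) w
  above-inserted [] = 0 , []
  above-inserted (_∷_ {x} {w} a≤x a≤w) with above-inserted a≤w | value a <? value x
  ... | n , i | yes a<x rewrite above-accept a x w a<x = n , there a<x i
  ... | n , i | no  a≮x rewrite above-reject a x w a≮x
    with refl ← value-injective {v = a} {w = x} (≤-antisym a≤x (≮⇒≥ a≮x)) = suc n , here i

  inserted-front : ∀ n {v} → All (a <ᴸ_) v → Inserted a n v (replicate n a ++ v)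
  inserted-front zero    []          = []
  inserted-front zero    (a<x ∷ a<v) = there a<x (inserted-front zero a<v)
  inserted-front (suc n) a<v         = here (inserted-front n a<v)

  -- With j at most minima v these are the normal forms: the copies of a stand
  -- together, as far left as j minima to their right permit.
  insert : ℕ → ℕ → Word → Word
  insert n j []      = replicate n a
  insert n j (x ∷ v) with minima (x ∷ v) ≤? j
  ... | yes _ = replicate n a ++ x ∷ v
  ... | no  _ = x ∷ insert n j v

  insert-front : ∀ n {j} v → minima v ≤ j → insert n j v ≡ replicate n a ++ v
  insert-front n []          _   = sym (++-identityʳ _)
  insert-front n {j} (x ∷ v) m≤j with minima (x ∷ v) ≤? j
  ... | yes _   = refl
  ... | no  m≰j = contradiction m≤j m≰j

  insert-later : ∀ n {j x} v → ¬ minima (x ∷ v) ≤ j → insert n j (x ∷ v) ≡ x ∷ insert n j v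
  insert-later n {j} {x} v m≰j with minima (x ∷ v) ≤? j
  ... | yes m≤j = contradiction m≤j m≰j
  ... | no  _   = refl

  insert-inserted : ∀ n j {v} → All (a <ᴸ_) v → Inserted a n v (insert n j v)
  insert-inserted n j [] = subst (Inserted a n []) (++-identityʳ _) (inserted-front n [])
  insert-inserted n j {x ∷ v} (a<x ∷ a<v) with minima (x ∷ v) ≤? j
  ... | yes _ = inserted-front n (a<x ∷ a<v)
  ... | no  _ = there a<x (insert-inserted n j a<v)

  -- The witness in `v` stays to the right of all the copies, so `x` can pass them one at a time.
  slide : ∀ n {x v} → a <ᴸ x → Any (λ b → a ≤ b < x ᴸ) v → x ∷ replicate n a ++ v ≈ replicate n a ++ x ∷ v
  slide zero    a<x any = ε
  slide (suc n) a<x any = ≈-sym (≈-swap (Any-++⁺ʳ (replicate n a) any)) ◅◅ ≈-∷ a (slide n a<x any)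

  between : ∀ x {v} → All (a <ᴸ_) v → Any (_<ᴸ x) v → Any (λ b → a ≤ b < x ᴸ) v
  between x (a<y ∷ _) (here y<x)  = here (<⇒≤ a<y , y<x)
  between x (_ ∷ a<v) (there any) = there (between x a<v any)

  -- A letter that is not a minimum leaves the number of minima unchanged. If the block is placed
  -- before `x`, it would also stand at the front of `v`, and `slide` carries it across `x`.
  insert-reject : ∀ n j {x v} → All (a <ᴸ_) (x ∷ v) → Any (_<ᴸ x) v → insert n j (x ∷ v) ≈ x ∷ insert n j v
  insert-reject n j {x} {v} (a<x ∷ a<v) any with minima (x ∷ v) ≤? j
  ... | yes m≤j = ≈-sym (slide n a<x (between x a<v any))
    ◅◅ ≈-reflexive (cong (x ∷_) (sym (insert-front n v (≤-trans (minima-≤ x v) m≤j))))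
  ... | no  _   = ε

  -- The copies already present act as the witness `b = a`, letting the new copy move right past
  -- every larger letter until it joins them.
  insert-∷ : ∀ n j {v} → All (a <ᴸ_) v → a ∷ insert (suc n) j v ≈ insert (suc (suc n)) j v
  insert-∷ n j []              = ε
  insert-∷ n j {x ∷ v} (a<x ∷ a<v) with minima (x ∷ v) ≤? j
  ... | yes _ = ε
  ... | no  _ = ≈-swap (inserted-any (≤-refl , a<x) (insert-inserted (suc n) j a<v)) ◅◅ ≈-∷ x (insert-∷ n j a<v)

  -- As `minima` is invariant, the block is in front of both words or of neither. In the latter
  -- case, at the exchanged letters, `c` is not a minimum and can be moved out by `insert-reject`;
  -- the witness survives the insertion and permits the exchange.
  insert-swap : ∀ n j {v v′} → All (a <ᴸ_) v → Swap v v′ → insert n j v ≈ insert n j v′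
  insert-swap n j {v} {v′} (_ ∷ a<v) s@(there {x} {u} {u′} s′) with minima (x ∷ u) ≤? j
  ... | yes m≤j =
    ≈-++ (replicate n a) (swap⇒≈ s)
    ◅◅ ≈-reflexive (sym (insert-front n v′ (subst (_≤ j) (minima-swap s) m≤j)))
    where
    swap⇒≈ : ∀ {w w′} → Swap w w′ → w ≈ w′
    swap⇒≈ (here any)    = ≈-swap any
    swap⇒≈ (there {x} s) = ≈-∷ x (swap⇒≈ s)
  ... | no  m≰j =
    ≈-∷ x (insert-swap n j a<v s′)
    ◅◅ ≈-reflexive (sym (insert-later n u′ (m≰j ∘ subst (_≤ j) (sym (minima-swap s)))))
  insert-swap n j a<v@(a<b ∷ a<c ∷ a<w) s@(here {b} {c} {w} any) with minima (b ∷ c ∷ w) ≤? j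
  ... | yes m≤j =
    ≈-++ (replicate n a) (≈-swap any)
    ◅◅ ≈-reflexive (sym (insert-front n (c ∷ b ∷ w) (subst (_≤ j) (minima-swap s) m≤j)))
  ... | no  m≰j =
    ≈-∷ b (insert-reject n j (a<c ∷ a<w) (Any.map proj₂ any))
    ◅◅ ≈-swap (inserted-any-tail any (insert-inserted n j a<w))
    ◅◅ ≈-reflexive (sym (trans (insert-later n (b ∷ w) m′≰j)
         (cong (c ∷_) (insert-later n w (m′≰j ∘ subst (_≤ j) (sym (minima-reject (here (between⇒< b c any)))))))))
    where
    m′≰j : ¬ minima (c ∷ b ∷ w) ≤ j
    m′≰j = m≰j ∘ subst (_≤ j) (sym (minima-swap s))

  insert-cong : ∀ n j {v v′} → All (a <ᴸ_) v → v ≈ v′ → insert n j v ≈ insert n j v′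
  insert-cong n j a<v ε = ε
  insert-cong n j a<v (fwd adj ◅ v≈v′) = insert-swap n j a<v s ◅◅ insert-cong n j (All-resp-↭ (swap⇒↭ s) a<v) v≈v′
    where s = adjacent⇒swap adj
  insert-cong n j a<v (bwd adj ◅ v≈v′) = ≈-sym (insert-swap n j a<u s) ◅◅ insert-cong n j a<u v≈v′
    where
    s = adjacent⇒swap adj
    a<u = All-resp-↭ (↭-sym (swap⇒↭ s)) a<v

  minima-front : ∀ n {v} → All (a <ᴸ_) v → minima (replicate n a ++ v) ≡ n + minima v
  minima-front zero    a<v = refl
  minima-front (suc n) a<v = trans (minima-accept (inserted-≥ (inserted-front n a<v))) (cong suc (minima-front n a<v))

  -- Letters to the left of the block have a smaller `a` to their right and are not minima. What
  -- remains are the copies, at least one of them, and the minima of `v` behind them.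
  minima-insert : ∀ n {j v} → All (a <ᴸ_) v → j ≤ minima v → minima (insert (suc n) j v) ≡ j + suc n
  minima-insert n {v = []} [] z≤n =
    trans (cong minima (sym (++-identityʳ (replicate (suc n) a))))
      (trans (minima-front (suc n) []) (+-identityʳ _))
  minima-insert n {j} {x ∷ v} (a<x ∷ a<v) j≤m with minima (x ∷ v) ≤? j
  ... | yes m≤j = begin
    minima (replicate (suc n) a ++ x ∷ v) ≡⟨ minima-front (suc n) (a<x ∷ a<v) ⟩
    suc n + minima (x ∷ v)                ≡⟨ +-comm (suc n) _ ⟩
    minima (x ∷ v) + suc n                ≡⟨ cong (_+ suc n) (≤-antisym m≤j j≤m) ⟩
    j + suc n                             ∎
    where
    open ≡-Reasoning
  -- Removing `x` loses at most one minimum, so the number still to the right cannot jump below `j`.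
  ... | no  m≰j = trans (minima-reject (inserted-any a<x (insert-inserted (suc n) j a<v)))
    (minima-insert n a<v (s≤s⁻¹ (<-≤-trans (≰⇒> m≰j) (minima-≤-suc x v))))

  -- Reading from the right, `j` is fixed at the last copy of `a` as the number of minima of `v`
  -- behind it. Further copies and larger letters to the left keep it.
  normalForm : ∀ {n v w} → Inserted a n v w →
    ∃ λ j → j ≤ minima v × minima w ≡ j + n × w ≈ insert n j v
  -- Without any copy of `a`, `minima v` is the default value that satisfies the equation for
  -- `minima w`.
  normalForm {zero} {v} i with refl ← inserted-zero i =
    minima v , ≤-refl , sym (+-identityʳ _) , ≈-reflexive (sym (insert-front 0 v ≤-refl))
  normalForm {suc zero} (here {v = v} i) with refl ← inserted-zero i =
    minima v , ≤-refl ,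
    trans (minima-accept (inserted-≥ i)) (sym (trans (+-suc (minima v) 0) (cong suc (+-identityʳ _)))) ,
    ≈-reflexive (sym (insert-front 1 v ≤-refl))
  normalForm {suc (suc n)} (here i) =
    let j , j≤m , m≡ , w≈ = normalForm i in
    j , j≤m , trans (minima-accept (inserted-≥ i)) (trans (cong suc m≡) (sym (+-suc j (suc n)))) ,
    ≈-∷ a w≈ ◅◅ insert-∷ n j (inserted-> i)
  normalForm {suc n} (there {v = v} {w} {x} a<x i) with normalForm i
  ... | j , j≤m , m≡ , w≈ =
    j , ≤-trans j≤m (minima-≤ x v) , trans (minima-reject (inserted-any a<x i)) m≡ ,
    ≈-∷ x w≈ ◅◅ later
    where
    later : x ∷ insert (suc n) j v ≈ insert (suc n) j (x ∷ v)
    later = [ accept , (λ any → ≈-sym (insert-reject (suc n) j (a<x ∷ inserted-> i) any)) ]′ (minimum? x v)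
      where
      accept : All (x ≤ᴸ_) v → x ∷ insert (suc n) j v ≈ insert (suc n) j (x ∷ v)
      -- A new minimum makes the count exceed `j`, so `insert` moves on past `x`.
      accept x≤v = ≈-reflexive (sym (insert-later (suc n) v λ m≤j →
        <⇒≱ (n<1+n j) (≤-trans (s≤s j≤m) (subst (_≤ j) (minima-accept x≤v) m≤j))))

-- Codes

-- For each letter, starting from the largest, a code records how many minima of
-- the subword of larger letters lie to the right of the last copy of the letter.
-- Then spine is the number of minima of the whole word.
Code : ∀ {k} → (Fin k → ℕ) → Set
spine : ∀ {k} {α : Fin k → ℕ} → Code α → ℕ
Code {zero}  α = ⊤
Code {suc k} α = Σ (Code (α ∘ suc)) λ c → Fin (suc (spine c))
spine {zero}      _       = 0
spine {suc k} {α} (c , j) = toℕ j + α zero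

content : ∀ {k} → (Fin k → Letter) → (Fin k → ℕ) → Word
content letter α = concat (tabulate λ j → replicate (α j) (letter j))

-- The index `j` is pinned down through `minima w`, an invariant of the class, instead of through
-- the position of the last copy.
HasCode : ∀ {k} → (Fin k → Letter) → (α : Fin k → ℕ) → Code α → Word → Set
HasCode {zero}  letter α _       w = w ≡ []
HasCode {suc k} letter α (c , j) w =
  HasCode (letter ∘ suc) (α ∘ suc) c (above (letter zero) w) × minima w ≡ toℕ j + α zero

minima≡spine : ∀ {k} (letter : Fin k → Letter) (α : Fin k → ℕ) {c w} →
  HasCode letter α c w → minima w ≡ spine c
minima≡spine {zero}  letter α refl      = refl
minima≡spine {suc k} letter α (_ , m≡) = m≡

-- Codes of rearrangements

module _ {k} (letter : Fin (suc k) → Letter) (increasing : StrictlyIncreasing letter) (α : Fin (suc k) → ℕ) where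

  private
    a = letter zero
    rest = content (letter ∘ suc) (α ∘ suc)

  content-> : All (a <ᴸ_) rest
  content-> = All-concat⁺ (All-tabulate⁺ λ j → All-replicate⁺ (α (suc j)) (increasing z<s))

  rearrangement-above : ∀ {w} → w ↭ content letter α → above a w ↭ rest
  rearrangement-above {w} w↭ = subst (above a w ↭_)
    (inserted-above (inserted-front (α zero) content->)) (filter-↭ (λ x → value a <? value x) w↭)

  -- All letters are at least `a`, so `w` is a shuffle of `above a w` with some number of copies of
  -- `a`; comparing lengths identifies that number.
  rearrangement-inserted : ∀ {w} → w ↭ content letter α → Inserted a (α zero) (above a w) w
  rearrangement-inserted {w} w↭ = subst (λ n → Inserted a n (above a w) w) n≡α₀ i
    where
    open ≡-Reasoning
    a≤w : All (a ≤ᴸ_) w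
    a≤w = All-resp-↭ (↭-sym w↭) (All-++⁺ (All-replicate⁺ (α zero) ≤-refl) (All.map <⇒≤ content->))
    n = proj₁ (above-inserted a≤w)
    i = proj₂ (above-inserted a≤w)
    length-front : ∀ n (v : Word) → length (replicate n a ++ v) ≡ n + length v
    length-front n v = trans (length-++ (replicate n a)) (cong (_+ length v) (length-replicate n))
    n≡α₀ : n ≡ α zero
    n≡α₀ = +-cancelʳ-≡ (length rest) n (α zero) (begin
      n + length rest                    ≡⟨ cong (n ℕ.+_) (↭-length (rearrangement-above w↭)) ⟨
      n + length (above a w)             ≡⟨ length-front n (above a w) ⟨
      length (replicate n a ++ above a w) ≡⟨ ↭-length (inserted-↭ i) ⟨
      length w                           ≡⟨ ↭-length w↭ ⟩
      length (content letter α)          ≡⟨ length-front (α zero) rest ⟩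
      α zero + length rest               ∎)

increasing-suc : ∀ {k} (letter : Fin (suc k) → Letter) → StrictlyIncreasing letter → StrictlyIncreasing (letter ∘ suc)
increasing-suc letter increasing p<q = increasing (s<s p<q)

hasCode : ∀ {k} (letter : Fin k → Letter) → StrictlyIncreasing letter → (α : Fin k → ℕ) →
  ∀ {w} → w ↭ content letter α → ∃ λ c → HasCode letter α c w
hasCode {zero}  letter inc α w↭ = tt , ↭-empty-inv w↭
hasCode {suc k} letter inc α {w} w↭ =
  let c , h = hasCode (letter ∘ suc) (increasing-suc letter inc) (α ∘ suc) (rearrangement-above letter inc α w↭)
      j , j≤m , m≡ , _ = normalForm (rearrangement-inserted letter inc α w↭)
      j<s = s≤s (subst (j ≤_) (minima≡spine (letter ∘ suc) (α ∘ suc) h) j≤m)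
  in (c , fromℕ< j<s) , h , trans m≡ (cong (_+ α zero) (sym (toℕ-fromℕ< j<s)))

-- Codes are well defined on classes: `above` respects equivalence, and `minima` is invariant under
-- it.
hasCode-unique : ∀ {k} (letter : Fin k → Letter) (α : Fin k → ℕ) {c c′ w w′} →
  w ≈ w′ → HasCode letter α c w → HasCode letter α c′ w′ → c ≡ c′
hasCode-unique {zero}  letter α w≈w′ h h′ = refl
hasCode-unique {suc k} letter α {c , j} {c′ , j′} w≈w′ (h , m≡) (h′ , m′≡)
  with refl ← hasCode-unique (letter ∘ suc) (α ∘ suc) (above-cong (letter zero) w≈w′) h h′
  = cong (c ,_) (toℕ-injective (+-cancelʳ-≡ (α zero) (toℕ j) (toℕ j′)
      (trans (sym m≡) (trans (minima-cong w≈w′) m′≡))))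

-- A code determines the normal form: the equal numbers of minima give the same `j`, and by
-- induction the restrictions to larger letters are equivalent, which `insert-cong` transfers to the
-- whole words.
hasCode-injective : ∀ {k} (letter : Fin k → Letter) → StrictlyIncreasing letter → (α : Fin k → ℕ) →
  ∀ {c w w′} → w ↭ content letter α → w′ ↭ content letter α →
  HasCode letter α c w → HasCode letter α c w′ → w ≈ w′
hasCode-injective {zero}  letter inc α _ _ refl refl = ε
hasCode-injective {suc k} letter inc α {c , j} {w} {w′} w↭ w′↭ (h , m≡) (h′ , m′≡) =
  let i , _ , mi≡ , w≈ = normalForm inserted
      i′ , _ , mi′≡ , w′≈ = normalForm (rearrangement-inserted letter inc α w′↭)
      i≡i′ = +-cancelʳ-≡ (α zero) i i′ (trans (sym mi≡) (trans (trans m≡ (sym m′≡)) mi′≡))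
      v≈v′ = hasCode-injective (letter ∘ suc) (increasing-suc letter inc) (α ∘ suc)
               (rearrangement-above letter inc α w↭) (rearrangement-above letter inc α w′↭) h h′
  in w≈
     ◅◅ insert-cong (α zero) i (inserted-> inserted) v≈v′
     ◅◅ ≈-reflexive (cong (λ i → insert (α zero) i (above (letter zero) w′)) i≡i′)
     ◅◅ ≈-sym w′≈
  where
  inserted = rearrangement-inserted letter inc α w↭

hasCode-surjective : ∀ {k} (letter : Fin k → Letter) → StrictlyIncreasing letter →
  (α : Fin k → ℕ) → (∀ j → 0 < α j) → (c : Code α) →
  ∃ λ w → w ↭ content letter α × HasCode letter α c w
hasCode-surjective {zero}  letter inc α pos c = [] , ↭-refl , refl
hasCode-surjective {suc k} letter inc α pos (c , j)
  with hasCode-surjective (letter ∘ suc) (increasing-suc letter inc) (α ∘ suc) (pos ∘ suc) c | α zero | pos zero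
-- Positivity of the part supplies the copy that `minima-insert` requires; without it, `j` would
-- leave no trace in the word.
... | v , v↭ , h | suc n | _ =
  w
  , ↭-trans (inserted-↭ inserted) (↭-++⁺ˡ (replicate (suc n) (letter zero)) v↭)
  , subst (HasCode (letter ∘ suc) (α ∘ suc) c) (sym (inserted-above inserted)) h
  , minima-insert n a<v (subst (toℕ j ≤_) (sym (minima≡spine (letter ∘ suc) (α ∘ suc) h)) (toℕ≤pred[n] j))
  where
  w = insert (suc n) (toℕ j) v
  a<v : All (letter zero <ᴸ_) v
  a<v = All-resp-↭ (↭-sym v↭) (content-> letter inc α)
  inserted : Inserted (letter zero) (suc n) v w
  inserted = insert-inserted (suc n) (toℕ j) a<v

-- The sum of F (spine c) over all codes c when s = 0; the general start s makes
-- the recursion reversible.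
countThen : ∀ {k} → ℕ → (Fin k → ℕ) → (ℕ → ℕ) → ℕ
countThen {zero}  s α F = F s
countThen {suc k} s α F = countThen s (α ∘ suc) λ s′ → Σ≤ s′ λ j → F (j + α zero)

-- The recursion of `countThen` peels off the innermost sum, at index zero, while `count` peels off
-- the outermost one. Extracting the last index reconciles them and produces the reversal by
-- `opposite`.
countThen-last : ∀ {k} s (α : Fin (suc k) → ℕ) F →
  countThen s α F ≡ Σ≤ s λ j → countThen (j + α (fromℕ k)) (α ∘ inject₁) F
countThen-last {zero}  s α F = refl
countThen-last {suc k} s α F = countThen-last s (α ∘ suc) λ s′ → Σ≤ s′ λ j → F (j + α zero)

countThen≡count : ∀ {k} s (α : Fin k → ℕ) → countThen s α (const 1) ≡ count s (α ∘ opposite)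
countThen≡count {zero}  s α = refl
countThen≡count {suc k} s α = trans (countThen-last s α (const 1))
  (Σ≤-cong s λ j → countThen≡count (j + α (fromℕ k)) (α ∘ inject₁))

-- Enumeration of the codes

Σ-Fin : ∀ {n} (f : Fin n → ℕ) → Σ (Fin n) (Fin ∘ f) ↔ Fin (sumℕ f)
Σ-Fin {zero}  f = mk↔ₛ′ (λ ()) (λ ()) (λ ()) (λ ())
Σ-Fin {suc n} f = ↔-sym +↔⊎ ↔-∘ ((↔-id _ ⊎-↔ Σ-Fin (f ∘ suc)) ↔-∘ uncons)
  where
  uncons : Σ (Fin (suc n)) (Fin ∘ f) ↔ (Fin (f zero) ⊎ Σ (Fin n) (Fin ∘ f ∘ suc))
  uncons = mk↔ₛ′ (λ { (zero , x) → inj₁ x ; (suc i , x) → inj₂ (i , x) })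
    [ (zero ,_) , (λ { (i , x) → suc i , x }) ]′
    (λ { (inj₁ _) → refl ; (inj₂ _) → refl }) (λ { (zero , _) → refl ; (suc _ , _) → refl })

-- Labels whose number `F` depends on the spine make the induction work: the index for the smallest
-- letter, together with its label, becomes a label of the shorter code.
Code-Fin : ∀ {k} (α : Fin k → ℕ) F → Σ (Code α) (Fin ∘ F ∘ spine) ↔ Fin (countThen 0 α F)
Code-Fin {zero}  α F = mk↔ₛ′ proj₂ (tt ,_) (λ _ → refl) (λ _ → refl)
Code-Fin {suc k} α F =
  Code-Fin (α ∘ suc) (λ s → Σ≤ s λ j → F (j + α zero)) ↔-∘ (congˡ (Σ-Fin _) ↔-∘ Σ-assoc)

Code↔Fin : ∀ {k} (α : Fin k → ℕ) → Code α ↔ Fin (countThen 0 α (const 1))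
Code↔Fin α = Code-Fin α (const 1) ↔-∘ mk↔ₛ′ (_, zero) proj₁ (λ { (_ , zero) → refl }) (λ _ → refl)

theorem4p2 : ∀ (n m : ℕ) (α : Composition n (suc m))
    (letter : Fin (suc m) → Letter) → StrictlyIncreasing letter →
    ∃ λ (N : ℕ) →
    HasClassCount (Sylvester letter (part α)) N
    × + N ≡ det (sylvesterMatrix (part α))
theorem4p2 n m α letter increasing =
  countThen 0 (part α) (const 1)
  , record
    { to        = to ∘ code
    ; cong      = λ {x} {y} w≈w′ → cong to (hasCode-unique letter (part α) w≈w′ (coded x) (coded y))
    ; bijective =
        (λ {x} {y} eq → hasCode-injective letter increasing (part α) (proj₂ x) (proj₂ y) (coded x)
          (subst (λ c → HasCode letter (part α) c (proj₁ y)) (sym (injective eq)) (coded y)))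
      , λ N → let w , w↭ , h = hasCode-surjective letter increasing (part α) (positive α) (from N) in
          (w , w↭) , λ {z} z≈w → trans (cong to (hasCode-unique letter (part α) z≈w (coded z) h)) (strictlyInverseˡ N)
    }
  , trans (cong +_ (countThen≡count 0 (part α))) (sym (det-sylvesterMatrix (part α)))
  where
  open Inverse (Code↔Fin (part α)) using (to; from; strictlyInverseˡ)
  open Injection (↔⇒↣ (Code↔Fin (part α))) using (injective)
  code : Rearrangement letter (part α) → Code (part α)
  code (w , w↭) = proj₁ (hasCode letter increasing (part α) w↭)
  coded : ∀ x → HasCode letter (part α) (code x) (proj₁ x)
  coded (w , w↭) = proj₂ (hasCode letter increasing (part α) w↭)
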